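{- Let $n\ge 6$ be an even integer, let $c$ be an integer with $1<c<n/2$, let $S=\{\pm 1,\pm c,n/2\}\subseteq\mathbb{Z}_n$, and assume that $\Gamma=\mathrm{Cay}(\mathbb{Z}_n;S)$ is closed distance magic. Assume that there exists $j\in\mathcal{J}_n(S)$ of type $2$. If $c$ is even, then $\Gamma$ is isomorphic to a graph $\mathrm{Cay}(\mathbb{Z}_n;\{\pm1,\pm c',n/2\})$ with $1<c'<n/2$ such that $n\equiv 2\pmod 4$, $c'$ is even, and $2(c'^2-1)$ is an odd multiple of $n$.
   Context: $\mathrm{Cay}(\mathbb{Z}_n;S)$ is the graph with vertex set $\mathbb{Z}_n$ in which $g,h$ are adjacent iff $h-g\in S$. A graph $\Gamma=(V,E)$ of order $n$ is closed distance magic if there are a bijection $\ell:V\to\{1,\ldots,n\}$ and a positive integer $r$ such that for all $u\in V$ the sum of the labels of $u$ and all its neighbors equals $r$. For $0\le j\le n-1$ let $\chi_j(x)=\cos(2\pi xj/n)+\mathbf{i}\sin(2\pi xj/n)$ and $\chi_j(S)=\sum_{x\in S}\chi_j(x)$; $\mathcal{J}_n(S)$ is the set of $j\in\{0,\ldots,n-1\}$ with $\chi_j(S)=-1$. An even $j\in\mathcal{J}_n(S)$ is of type $2$ if $\{\frac{2\pi j}{n},\frac{2\pi jc}{n}\}=\{\pm\frac{2\pi}{3}+2k_1\pi,\pm\frac{2\pi}{3}+2k_2\pi\}$ for some $k_1,k_2\in\mathbb{Z}$ and some (independent) choice of signs. -}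

module Defs where

open import Algebra.Definitions.RawSemiring using () renaming (_^_ to pow)
open import Data.Fin.Base using (Fin; toℕ)
open import Data.Fin.Properties using (toℕ-fromℕ<; toℕ-injective; toℕ<n) renaming (_≟_ to _≟ᶠ_)
open import Data.Fin.Subset using (Subset; _∈_; _∉_; _∪_; ⁅_⁆)
open import Data.Fin.Subset.Properties using (_∈?_; x∈p∪q⁻; x∈p∪q⁺; x∈⁅x⁆; x∈⁅y⁆⇒x≡y)
open import Data.Integer.Base using (ℤ; +_)
open import Data.List.Base using (List; allFin; filter; foldr; map)
open import Data.Nat.Base using (ℕ; zero; suc; _!; NonZero; z≤n; s≤s)
open import Data.Nat.DivMod using (_mod_; m%n<n; m<n⇒m%n≡m; %-remove-+ʳ; m*n/n≡m; n%n≡0; %-distribˡ-+; [m+n]%n≡m%n; m/n≤m)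
open import Data.Nat.Divisibility using (_∣_; divides; m%n≡0⇒n∣m)
open import Data.Nat.ListAction using (sum)
open import Data.Nat.Properties using (_!≢0; +-comm; +-assoc; m∸n+n≡m; m+[n∸m]≡n; <⇒≤; <-≤-trans; <-trans; m<m+n; +-identityʳ; *-comm)
open import Data.Product.Base using (Σ-syntax; ∃-syntax; _×_; _,_)
open import Data.Rational.Base using (ℚ; 0ℚ; 1ℚ; _/_)
open import Data.Sign.Base using (Sign)
open import Data.Sum.Base using (_⊎_; inj₁; inj₂)
open import Function.Bundles using (_⤖_; _⇔_; module Bijection)
open import Level using (0ℓ)
open import Relation.Binary.Core using (Rel)
open import Relation.Binary.Definitions using (Decidable; Symmetric)
open import Relation.Binary.PropositionalEquality using (_≡_; refl; sym; trans; cong; cong₂; subst; module ≡-Reasoning)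
open import Relation.Nullary.Decidable using (_⊎-dec_)
open import Relation.Nullary.Negation using (¬_)

import Data.Nat.Base as ℕ
import Data.Rational.Base as ℚ

record Graph (n : ℕ) : Set₁ where
  field
    _~_         : Rel (Fin n) 0ℓ
    _~?_        : Decidable _~_
    symmetric   : Symmetric _~_
    irreflexive : ∀ {u} → ¬ (u ~ u)

_≅_ : ∀ {m n} → Graph m → Graph n → Set
_≅_ {m} {n} G H =
  Σ[ f ∈ Fin m ⤖ Fin n ]
    (∀ u v → (u ~ᴳ v) ⇔ (Bijection.to f u ~ᴴ Bijection.to f v))
  where
  open Graph G using () renaming (_~_ to _~ᴳ_)
  open Graph H using () renaming (_~_ to _~ᴴ_)

closedNeighbourhood : ∀ {n} → Graph n → Fin n → List (Fin n)
closedNeighbourhood {n} G u = filter (λ v → (u ≟ᶠ v) ⊎-dec (u ~? v)) (allFin n)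
  where open Graph G

-- A bijection ℓ : V → {1,…,n} is given by a bijection onto Fin n = {0,…,n-1},
-- the label of v being 1 + ℓ(v).
label : ∀ {n} → Fin n ⤖ Fin n → Fin n → ℕ
label ℓ v = suc (toℕ (Bijection.to ℓ v))

ClosedDistanceMagic : ∀ {n} → Graph n → Set
ClosedDistanceMagic {n} G =
  Σ[ ℓ ∈ Fin n ⤖ Fin n ] ∃[ r ]
    0 ℕ.< r × (∀ u → sum (map (label ℓ) (closedNeighbourhood G u)) ≡ r)

module _ {n : ℕ} .{{_ : NonZero n}} where

  [_] : ℕ → Fin n
  [ x ] = x mod n

  neg : Fin n → Fin n
  neg x = [ n ℕ.∸ toℕ x ]

  infixl 6 _⊖_
  _⊖_ : Fin n → Fin n → Fin n
  h ⊖ g = [ toℕ h ℕ.+ (n ℕ.∸ toℕ g) ]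

  toℕ-[] : ∀ x → toℕ [ x ] ≡ x ℕ.% n
  toℕ-[] x = toℕ-fromℕ< (m%n<n x n)

  []-toℕ : ∀ (x : Fin n) → [ toℕ x ] ≡ x
  []-toℕ x = toℕ-injective (trans (toℕ-[] (toℕ x)) (m<n⇒m%n≡m (toℕ<n x)))

  []-+ : ∀ a b → (toℕ [ a ] ℕ.+ toℕ [ b ]) ℕ.% n ≡ (a ℕ.+ b) ℕ.% n
  []-+ a b = trans (cong (ℕ._% n) (cong₂ ℕ._+_ (toℕ-[] a) (toℕ-[] b)))
                   (sym (%-distribˡ-+ a b n))

  neg-unique : ∀ (x y : Fin n) → (toℕ x ℕ.+ toℕ y) ℕ.% n ≡ 0 → neg x ≡ y
  neg-unique x y eq = toℕ-injective (begin
    toℕ (neg x)                                        ≡⟨ toℕ-[] _ ⟩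
    (n ℕ.∸ toℕ x) ℕ.% n                                ≡⟨ %-remove-+ʳ (n ℕ.∸ toℕ x) (m%n≡0⇒n∣m _ n eq) ⟨
    ((n ℕ.∸ toℕ x) ℕ.+ (toℕ x ℕ.+ toℕ y)) ℕ.% n        ≡⟨ cong (ℕ._% n) (+-assoc (n ℕ.∸ toℕ x) (toℕ x) (toℕ y)) ⟨
    ((n ℕ.∸ toℕ x ℕ.+ toℕ x) ℕ.+ toℕ y) ℕ.% n          ≡⟨ cong (λ z → (z ℕ.+ toℕ y) ℕ.% n) (m∸n+n≡m (<⇒≤ (toℕ<n x))) ⟩
    (n ℕ.+ toℕ y) ℕ.% n                                ≡⟨ cong (ℕ._% n) (+-comm n (toℕ y)) ⟩
    (toℕ y ℕ.+ n) ℕ.% n                                ≡⟨ [m+n]%n≡m%n (toℕ y) n ⟩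
    toℕ y ℕ.% n                                        ≡⟨ m<n⇒m%n≡m (toℕ<n y) ⟩
    toℕ y                                              ∎)
    where open ≡-Reasoning

  x+neg : ∀ (x : Fin n) → (toℕ x ℕ.+ toℕ (neg x)) ℕ.% n ≡ 0
  x+neg x = begin
    (toℕ x ℕ.+ toℕ (neg x)) ℕ.% n                ≡⟨ cong (λ z → (toℕ z ℕ.+ toℕ (neg x)) ℕ.% n) ([]-toℕ x) ⟨
    (toℕ [ toℕ x ] ℕ.+ toℕ (neg x)) ℕ.% n        ≡⟨ []-+ (toℕ x) (n ℕ.∸ toℕ x) ⟩
    (toℕ x ℕ.+ (n ℕ.∸ toℕ x)) ℕ.% n              ≡⟨ cong (ℕ._% n) (m+[n∸m]≡n (<⇒≤ (toℕ<n x))) ⟩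
    n ℕ.% n                                      ≡⟨ n%n≡0 n ⟩
    0                                            ∎
    where open ≡-Reasoning

  neg-involutive : ∀ (x : Fin n) → neg (neg x) ≡ x
  neg-involutive x = neg-unique (neg x) x
    (trans (cong (ℕ._% n) (+-comm (toℕ (neg x)) (toℕ x))) (x+neg x))

  neg-⊖ : ∀ g h → neg (h ⊖ g) ≡ g ⊖ h
  neg-⊖ g h = neg-unique (h ⊖ g) (g ⊖ h) (begin
    (toℕ (h ⊖ g) ℕ.+ toℕ (g ⊖ h)) ℕ.% n                    ≡⟨ []-+ (H ℕ.+ G′) (G ℕ.+ H′) ⟩
    ((H ℕ.+ G′) ℕ.+ (G ℕ.+ H′)) ℕ.% n                      ≡⟨ cong (ℕ._% n) (+-comm (H ℕ.+ G′) (G ℕ.+ H′)) ⟩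
    ((G ℕ.+ H′) ℕ.+ (H ℕ.+ G′)) ℕ.% n                      ≡⟨ cong (ℕ._% n) (+-assoc G H′ (H ℕ.+ G′)) ⟩
    (G ℕ.+ (H′ ℕ.+ (H ℕ.+ G′))) ℕ.% n                      ≡⟨ cong (λ z → (G ℕ.+ z) ℕ.% n) (+-assoc H′ H G′) ⟨
    (G ℕ.+ ((H′ ℕ.+ H) ℕ.+ G′)) ℕ.% n                      ≡⟨ cong (λ z → (G ℕ.+ (z ℕ.+ G′)) ℕ.% n) (m∸n+n≡m (<⇒≤ (toℕ<n h))) ⟩
    (G ℕ.+ (n ℕ.+ G′)) ℕ.% n                               ≡⟨ cong (λ z → (G ℕ.+ z) ℕ.% n) (+-comm n G′) ⟩
    (G ℕ.+ (G′ ℕ.+ n)) ℕ.% n                               ≡⟨ cong (ℕ._% n) (+-assoc G G′ n) ⟨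
    ((G ℕ.+ G′) ℕ.+ n) ℕ.% n                               ≡⟨ [m+n]%n≡m%n (G ℕ.+ G′) n ⟩
    (G ℕ.+ G′) ℕ.% n                                       ≡⟨ cong (ℕ._% n) (m+[n∸m]≡n (<⇒≤ (toℕ<n g))) ⟩
    n ℕ.% n                                                ≡⟨ n%n≡0 n ⟩
    0                                                      ∎)
    where
    open ≡-Reasoning
    G  = toℕ g
    H  = toℕ h
    G′ = n ℕ.∸ toℕ g
    H′ = n ℕ.∸ toℕ h

  toℕ-[0] : toℕ [ 0 ] ≡ 0
  toℕ-[0] = trans (toℕ-[] 0) (m<n⇒m%n≡m (ℕ.>-nonZero⁻¹ n))

  neg-[0] : neg [ 0 ] ≡ [ 0 ]
  neg-[0] = neg-unique [ 0 ] [ 0 ] (trans ([]-+ 0 0) (m<n⇒m%n≡m (ℕ.>-nonZero⁻¹ n)))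

  ⊖-self : ∀ g → g ⊖ g ≡ [ 0 ]
  ⊖-self g = toℕ-injective (begin
    toℕ (g ⊖ g)                          ≡⟨ toℕ-[] _ ⟩
    (toℕ g ℕ.+ (n ℕ.∸ toℕ g)) ℕ.% n      ≡⟨ cong (ℕ._% n) (m+[n∸m]≡n (<⇒≤ (toℕ<n g))) ⟩
    n ℕ.% n                              ≡⟨ n%n≡0 n ⟩
    0                                    ≡⟨ toℕ-[0] ⟨
    toℕ [ 0 ]                            ∎)
    where open ≡-Reasoning

  Cay : (S : Subset n) → [ 0 ] ∉ S → (∀ {x} → x ∈ S → neg x ∈ S) → Graph n
  Cay S 0∉S S-symmetric = record
    { _~_         = λ g h → (h ⊖ g) ∈ S
    ; _~?_        = λ g h → (h ⊖ g) ∈? S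
    ; symmetric   = λ {g} {h} h⊖g∈S → subst (_∈ S) (neg-⊖ g h) (S-symmetric h⊖g∈S)
    ; irreflexive = λ {g} g⊖g∈S → 0∉S (subst (_∈ S) (⊖-self g) g⊖g∈S)
    }

module _ (n : ℕ) .{{_ : NonZero n}} (c : ℕ) where

  connectionSet : Subset n
  connectionSet =
    ⁅ [ 1 ] ⁆ ∪ (⁅ neg [ 1 ] ⁆ ∪ (⁅ [ c ] ⁆ ∪ (⁅ neg [ c ] ⁆ ∪ ⁅ [ n ℕ./ 2 ] ⁆)))

  private
    Listed : Fin n → Set
    Listed x = x ≡ [ 1 ] ⊎ (x ≡ neg [ 1 ] ⊎ (x ≡ [ c ] ⊎ (x ≡ neg [ c ] ⊎ x ≡ [ n ℕ./ 2 ])))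

    ∪-map : ∀ {x y : Fin n} {S : Subset n} {P : Set} → (x ∈ S → P) → x ∈ ⁅ y ⁆ ∪ S → x ≡ y ⊎ P
    ∪-map {y = y} {S} f x∈ with x∈p∪q⁻ ⁅ y ⁆ S x∈
    ... | inj₁ p = inj₁ (x∈⁅y⁆⇒x≡y y p)
    ... | inj₂ q = inj₂ (f q)

    listed⁻ : ∀ {x} → x ∈ connectionSet → Listed x
    listed⁻ = ∪-map (∪-map (∪-map (∪-map (x∈⁅y⁆⇒x≡y _))))

    listed⁺ : ∀ {x} → Listed x → x ∈ connectionSet
    listed⁺ (inj₁ refl)                      = x∈p∪q⁺ (inj₁ (x∈⁅x⁆ _))
    listed⁺ (inj₂ (inj₁ refl))               = x∈p∪q⁺ (inj₂ (x∈p∪q⁺ (inj₁ (x∈⁅x⁆ _))))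
    listed⁺ (inj₂ (inj₂ (inj₁ refl)))        =
      x∈p∪q⁺ (inj₂ (x∈p∪q⁺ (inj₂ (x∈p∪q⁺ (inj₁ (x∈⁅x⁆ _))))))
    listed⁺ (inj₂ (inj₂ (inj₂ (inj₁ refl)))) =
      x∈p∪q⁺ (inj₂ (x∈p∪q⁺ (inj₂ (x∈p∪q⁺ (inj₂ (x∈p∪q⁺ (inj₁ (x∈⁅x⁆ _))))))))
    listed⁺ (inj₂ (inj₂ (inj₂ (inj₂ refl)))) =
      x∈p∪q⁺ (inj₂ (x∈p∪q⁺ (inj₂ (x∈p∪q⁺ (inj₂ (x∈p∪q⁺ (inj₂ (x∈⁅x⁆ _))))))))

    half+half : 2 ∣ n → n ℕ./ 2 ℕ.+ n ℕ./ 2 ≡ n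
    half+half (divides q eq) = begin
      n ℕ./ 2 ℕ.+ n ℕ./ 2  ≡⟨ cong₂ ℕ._+_ half half ⟩
      q ℕ.+ q              ≡⟨ cong (q ℕ.+_) (+-identityʳ q) ⟨
      2 ℕ.* q              ≡⟨ *-comm 2 q ⟩
      q ℕ.* 2              ≡⟨ eq ⟨
      n                    ∎
      where
      open ≡-Reasoning
      half : n ℕ./ 2 ≡ q
      half = trans (cong (ℕ._/ 2) eq) (m*n/n≡m q 2)

    neg-half : 2 ∣ n → neg [ n ℕ./ 2 ] ≡ [ n ℕ./ 2 ]
    neg-half 2∣n = neg-unique [ n ℕ./ 2 ] [ n ℕ./ 2 ]
      (trans ([]-+ (n ℕ./ 2) (n ℕ./ 2)) (trans (cong (ℕ._% n) (half+half 2∣n)) (n%n≡0 n)))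

    [x]≢0 : ∀ {x} → 0 ℕ.< x → x ℕ.< n → ¬ ([ 0 ] ≡ [ x ])
    [x]≢0 {x} 0<x x<n eq with trans (sym (toℕ-[0] {n})) (trans (cong toℕ eq) (trans (toℕ-[] x) (m<n⇒m%n≡m x<n)))
    [x]≢0 () x<n eq | refl

    neg[x]≢0 : ∀ {x} → 0 ℕ.< x → x ℕ.< n → ¬ ([ 0 ] ≡ neg [ x ])
    neg[x]≢0 {x} 0<x x<n eq =
      [x]≢0 0<x x<n (trans (sym neg-[0]) (trans (cong neg eq) (neg-involutive [ x ])))

    half<n : 0 ℕ.< n ℕ./ 2 → 2 ∣ n → n ℕ./ 2 ℕ.< n
    half<n 0<half 2∣n = subst (n ℕ./ 2 ℕ.<_) (half+half 2∣n) (m<m+n (n ℕ./ 2) 0<half)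

  0∉connectionSet : 2 ∣ n → 1 ℕ.< c → c ℕ.< n ℕ./ 2 → [ 0 ] ∉ connectionSet
  0∉connectionSet 2∣n 1<c c<n/2 0∈ with listed⁻ 0∈
  ... | inj₁ p                      = [x]≢0 (s≤s z≤n) (<-≤-trans (<-trans 1<c c<n/2) (m/n≤m n 2)) p
  ... | inj₂ (inj₁ p)               = neg[x]≢0 (s≤s z≤n) (<-≤-trans (<-trans 1<c c<n/2) (m/n≤m n 2)) p
  ... | inj₂ (inj₂ (inj₁ p))        = [x]≢0 (<-trans (s≤s z≤n) 1<c) (<-≤-trans c<n/2 (m/n≤m n 2)) p
  ... | inj₂ (inj₂ (inj₂ (inj₁ p))) = neg[x]≢0 (<-trans (s≤s z≤n) 1<c) (<-≤-trans c<n/2 (m/n≤m n 2)) p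
  ... | inj₂ (inj₂ (inj₂ (inj₂ p))) = [x]≢0 0<half (half<n 0<half 2∣n) p
    where
    0<half : 0 ℕ.< n ℕ./ 2
    0<half = <-trans (<-trans (s≤s z≤n) 1<c) c<n/2

  connectionSet-symmetric : 2 ∣ n → ∀ {x} → x ∈ connectionSet → neg x ∈ connectionSet
  connectionSet-symmetric 2∣n x∈ with listed⁻ x∈
  ... | inj₁ refl                      = listed⁺ (inj₂ (inj₁ refl))
  ... | inj₂ (inj₁ refl)               = listed⁺ (inj₁ (neg-involutive [ 1 ]))
  ... | inj₂ (inj₂ (inj₁ refl))        = listed⁺ (inj₂ (inj₂ (inj₂ (inj₁ refl))))
  ... | inj₂ (inj₂ (inj₂ (inj₁ refl))) = listed⁺ (inj₂ (inj₂ (inj₁ (neg-involutive [ c ]))))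
  ... | inj₂ (inj₂ (inj₂ (inj₂ refl))) = listed⁺ (inj₂ (inj₂ (inj₂ (inj₂ (neg-half 2∣n)))))

  CayConnectionSet : 2 ∣ n → 1 ℕ.< c → c ℕ.< n ℕ./ 2 → Graph n
  CayConnectionSet 2∣n 1<c c<n/2 =
    Cay connectionSet (0∉connectionSet 2∣n 1<c c<n/2) (connectionSet-symmetric 2∣n)

-- A real number is represented by a sequence of rationals converging to it;
-- two representatives denote the same number when their difference tends to 0.
-- Convergence is not carried as a field: the only sequences built below are
-- constants and π, which converge, and the results of _+ᴿ_, _·_, cos and sin
-- applied to them, and these operations preserve convergence.
ℝ : Set
ℝ = ℕ → ℚ

infix 4 _≃_
_≃_ : ℝ → ℝ → Set
a ≃ b = ∀ ε → 0ℚ ℚ.< ε → ∃[ N ] (∀ k → N ℕ.≤ k → ℚ.∣ a k ℚ.- b k ∣ ℚ.< ε)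

const : ℚ → ℝ
const q _ = q

infixl 6 _+ᴿ_
_+ᴿ_ : ℝ → ℝ → ℝ
(a +ᴿ b) k = a k ℚ.+ b k

infixr 7 _·_
_·_ : ℚ → ℝ → ℝ
(q · a) k = q ℚ.* a k

infixr 8 _^_
_^_ : ℚ → ℕ → ℚ
_^_ = pow ℚ.+-*-rawSemiring

∑≤ : ℕ → (ℕ → ℚ) → ℚ
∑≤ zero    f = f 0
∑≤ (suc k) f = ∑≤ k f ℚ.+ f (suc k)

-- Leibniz: π = 4 (1 - 1/3 + 1/5 - …).
π : ℝ
π k = (+ 4 / 1) ℚ.* ∑≤ k (λ i → (ℚ.- 1ℚ) ^ i ℚ.* (+ 1 / suc (2 ℕ.* i)))

-- The k-th approximation is the k-th Taylor polynomial at the k-th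
-- approximation of the argument; as the Taylor series converge uniformly on
-- bounded sets, this converges to cos (resp. sin) of the limit of a.
cos : ℝ → ℝ
cos a k = ∑≤ k (λ i → (ℚ.- 1ℚ) ^ i ℚ.* (a k ^ (2 ℕ.* i) ℚ.* (+ 1 / ((2 ℕ.* i) !)) {{(2 ℕ.* i) !≢0}}))

sin : ℝ → ℝ
sin a k = ∑≤ k (λ i → (ℚ.- 1ℚ) ^ i ℚ.* (a k ^ suc (2 ℕ.* i) ℚ.* (+ 1 / (suc (2 ℕ.* i) !)) {{suc (2 ℕ.* i) !≢0}}))

record ℂ : Set where
  constructor _+i_
  field
    re : ℝ
    im : ℝ

open ℂ public

infixl 6 _+ᶜ_
_+ᶜ_ : ℂ → ℂ → ℂ
(a +i b) +ᶜ (a′ +i b′) = (a +ᴿ a′) +i (b +ᴿ b′)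

0ᶜ -1ᶜ : ℂ
0ᶜ  = const 0ℚ +i const 0ℚ
-1ᶜ = const (ℚ.- 1ℚ) +i const 0ℚ

infix 4 _≃ᶜ_
_≃ᶜ_ : ℂ → ℂ → Set
z ≃ᶜ w = re z ≃ re w × im z ≃ im w

module _ {n : ℕ} .{{_ : NonZero n}} where

  χ : Fin n → Fin n → ℂ
  χ j x = cos θ +i sin θ
    where
    θ : ℝ
    θ = (+ (2 ℕ.* toℕ x ℕ.* toℕ j) / n) · π

  χ[_] : Fin n → Subset n → ℂ
  χ[ j ] S = foldr (λ x z → χ j x +ᶜ z) 0ᶜ (filter (_∈? S) (allFin n))

  𝒥 : Subset n → Fin n → Set
  𝒥 S j = χ[ j ] S ≃ᶜ -1ᶜ

-- {a, b} = {a′, b′} as sets of real numbers: each is included in the other.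
SamePair : (a b a′ b′ : ℝ) → Set
SamePair a b a′ b′ =
  ((a ≃ a′ ⊎ a ≃ b′) × (b ≃ a′ ⊎ b ≃ b′)) ×
  ((a′ ≃ a ⊎ a′ ≃ b) × (b′ ≃ a ⊎ b′ ≃ b))

±2π/3+2kπ : Sign → ℤ → ℝ
±2π/3+2kπ Sign.+ k = ((+ 2 / 3) · π) +ᴿ (((+ 2 / 1) ℚ.* (k / 1)) · π)
±2π/3+2kπ Sign.- k = ((ℚ.- (+ 2 / 3)) · π) +ᴿ (((+ 2 / 1) ℚ.* (k / 1)) · π)

record Type2 (n : ℕ) .{{_ : NonZero n}} (c : ℕ) (j : Fin n) : Set where
  field
    j∈𝒥    : 𝒥 (connectionSet n c) j
    j-even : 2 ∣ toℕ j
    angles : ∃[ s₁ ] ∃[ s₂ ] ∃[ k₁ ] ∃[ k₂ ]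
             SamePair ((+ (2 ℕ.* toℕ j) / n) · π)
                      ((+ (2 ℕ.* toℕ j ℕ.* c) / n) · π)
                      (±2π/3+2kπ s₁ k₁)
                      (±2π/3+2kπ s₂ k₂)

{-# OPTIONS --safe #-}
module Submission where

-- One may take c′ = c.  Write n = 2N, p = c − 1, q = c + 1 (both odd), let T be
-- the shift x ↦ x + 1 and let F be the labelling of ℤₙ, rescaled so that its
-- closed neighbourhood sums vanish:
--   (1 + T^p)(1 + T^q) F + T^c (1 + T^N) F = 0.
-- The odd part g = (1 − T^N) F satisfies (1 + T^p)(1 + T^q) g = 0.  If N were
-- even, then T^N g = −g and the parity of p and q would force g = 0, against
-- injectivity.  In general (T^(2pq) − 1)² g = 0, so T^(2pq) g = g as T has finite
-- order.  The even part h = (1 + T^N) F satisfies (1 + T^p)(1 + T^q) h = −2 T^c h,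
-- so T^(4pq) is the identity modulo 2 on the lattice of solutions; as it has odd
-- order dividing N, halving (T^(4pq) − 1) h repeatedly shows T^(4pq) h = h.
-- Hence F has period 4pq, and injectivity gives 2N ∣ 4pq, i.e. N ∣ c² − 1.

open import Defs
open import Data.Integer.Properties using (+-0-abelianGroup; +-identityˡ; +-inverseʳ; +-injective; i-j≡0⇒i≡j; i≡j⇒i-j≡0; *-cancelˡ-≡; *-cancelʳ-≡; i*j≡0⇒i≡0∨j≡0; abs-*; ∣i∣≡0⇒i≡0)
open import Algebra.Properties.AbelianGroup +-0-abelianGroup using () renaming (∙-cancelʳ to +-cancelʳ)
open import Data.Fin.Base using (Fin; toℕ)
open import Data.Fin.Properties using (toℕ-injective; toℕ<n)
open import Data.Fin.Subset using (⁅_⁆) renaming (_∈_ to _∈ˢ_)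
open import Data.Fin.Subset.Properties using (x∈p∪q⁻; x∈p∪q⁺; x∈⁅x⁆; x∈⁅y⁆⇒x≡y)
open import Data.Integer.Base as ℤ using (ℤ; +_; 0ℤ; ∣_∣)
open import Data.Integer.Divisibility.Signed as ℤᵈ using (divides; quotient; 0∣⇒≡0; ∣m∣n⇒∣m+n; ∣m∣n⇒∣m-n; ∣⇒∣ᵤ; ∣ᵤ⇒∣)
import Data.Integer.Tactic.RingSolver as ℤ-Ring
open import Data.List.Base using (List; []; _∷_; allFin; map)
open import Data.List.Membership.Propositional using (_∈_)
open import Data.List.Membership.Propositional.Properties using (∈-allFin; ∈-filter⁺; ∈-filter⁻)
open import Data.List.Membership.Propositional.Properties.WithK using (unique∧set⇒bag)
open import Data.List.Properties using (map-cong; map-∘)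
open import Data.List.Relation.Binary.BagAndSetEquality using (∼bag⇒↭)
open import Data.List.Relation.Binary.Permutation.Propositional using (_↭_)
open import Data.List.Relation.Binary.Permutation.Propositional.Properties using () renaming (map⁺ to ↭-map⁺)
open import Data.List.Relation.Unary.AllPairs as AllPairs using ()
open import Data.List.Relation.Unary.AllPairs.Properties using () renaming (map⁺ to AllPairs-map⁺)
open import Data.List.Relation.Unary.Any using (here; there)
open import Data.List.Relation.Unary.Linked using (Linked; [-]; _∷_)
open import Data.List.Relation.Unary.Linked.Properties using (Linked⇒AllPairs)
open import Data.List.Relation.Unary.Unique.Propositional using (Unique)
open import Data.List.Relation.Unary.Unique.Propositional.Properties using (filter⁺; allFin⁺)
open import Data.Nat.Base using (ℕ; zero; suc; NonZero; _+_; _≤_; _<_; _*_; _∸_; _/_; _%_; z≤n; s≤s; >-nonZero)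
open import Data.Nat.Coprimality using (Coprime; coprime-divisor)
open import Data.Nat.DivMod using (m<n⇒m%n≡m; [m+n]%n≡m%n; [m+kn]%n≡m%n; m/n*n≡m; m≡m%n+[m/n]*n; m%n<n)
open import Data.Nat.Divisibility using (_∣_; divides; ∣m+n∣m⇒∣n; ∣1⇒≡1; ∣m⇒∣m*n; m%n≡0⇒n∣m; *-cancelʳ-∣)
open import Data.Nat.ListAction using (sum)
open import Data.Nat.ListAction.Properties using (sum-↭)
open import Data.Nat.Primality using (euclidsLemma; prime[2]; irreducible[2])
open import Data.Nat.Properties using (+-assoc; +-comm; +-identityʳ; *-comm; <-trans; <⇒≤; <⇒≢; ≤-refl; ≤-trans; <-≤-trans; n≤0⇒n≡0; m∸n+n≡m; m+[n∸m]≡n; m+n≤o⇒m≤o∸n; +-monoʳ-<; ∸-monoʳ-<; m<m+n; m≤m+n; m≤m*n; suc-injective)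
import Data.Nat.Tactic.RingSolver as ℕ-Ring
open import Data.Product.Base using (Σ-syntax; ∃-syntax; _×_; _,_; proj₂)
open import Data.Sum.Base using (_⊎_; inj₁; inj₂; fromInj₂)
open import Function.Bundles using (_⤖_; mk⇔; module Bijection)
open import Function.Construct.Identity using (⤖-id; ⇔-id)
open import Relation.Binary.PropositionalEquality using (_≡_; refl; sym; trans; cong; cong₂; subst; module ≡-Reasoning)
open import Relation.Nullary.Negation using (¬_; contradiction)

-- Periodic and antiperiodic integer sequences modulo `d`.

-- For d = 0 the two notions are the exact ones.
Periodic Antiperiodic : ℤ → (ℕ → ℤ) → ℕ → Set
Periodic     d u p = ∀ x → d ℤᵈ.∣ u (x + p) ℤ.- u x
Antiperiodic d u p = ∀ x → d ℤᵈ.∣ u (x + p) ℤ.+ u x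

Periodic-+ : ∀ {d p q} u → Periodic d u p → Periodic d u q → Periodic d u (p + q)
Periodic-+ {d} {p} {q} u per-p per-q x = subst (d ℤᵈ.∣_) eq (∣m∣n⇒∣m+n (per-q (x + p)) (per-p x))
  where
  ring : ∀ a b e → (a ℤ.- b) ℤ.+ (b ℤ.- e) ≡ a ℤ.- e
  ring = ℤ-Ring.solve-∀
  eq : (u (x + p + q) ℤ.- u (x + p)) ℤ.+ (u (x + p) ℤ.- u x) ≡ u (x + (p + q)) ℤ.- u x
  eq = trans (ring (u (x + p + q)) (u (x + p)) (u x)) (cong (λ y → u y ℤ.- u x) (+-assoc x p q))

Periodic-0 : ∀ {d} u → Periodic d u 0
Periodic-0 u x = divides 0ℤ (i≡j⇒i-j≡0 (cong u (+-identityʳ x)))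

Periodic-* : ∀ {d p} u m → Periodic d u p → Periodic d u (m * p)
Periodic-* u zero    per = Periodic-0 u
Periodic-* u (suc m) per = Periodic-+ u per (Periodic-* u m per)

Antiperiodic⇒Periodic : ∀ {d p} u → Antiperiodic d u p → Periodic d u (p + p)
Antiperiodic⇒Periodic {d} {p} u anti x = subst (d ℤᵈ.∣_) eq (∣m∣n⇒∣m-n (anti (x + p)) (anti x))
  where
  ring : ∀ a b e → (a ℤ.+ b) ℤ.- (b ℤ.+ e) ≡ a ℤ.- e
  ring = ℤ-Ring.solve-∀
  eq : (u (x + p + p) ℤ.+ u (x + p)) ℤ.- (u (x + p) ℤ.+ u x) ≡ u (x + (p + p)) ℤ.- u x
  eq = trans (ring (u (x + p + p)) (u (x + p)) (u x)) (cong (λ y → u y ℤ.- u x) (+-assoc x p p))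

Periodic-0⇒≡ : ∀ {p} u → Periodic 0ℤ u p → ∀ x → u (x + p) ≡ u x
Periodic-0⇒≡ u per x = i-j≡0⇒i≡j _ _ (0∣⇒≡0 (per x))

2i≡0⇒i≡0 : ∀ {i} → i ℤ.+ i ≡ 0ℤ → i ≡ 0ℤ
2i≡0⇒i≡0 {i} eq = *-cancelʳ-≡ i 0ℤ (+ 2) (trans (ring i) eq)
  where
  ring : ∀ j → j ℤ.* + 2 ≡ j ℤ.+ j
  ring = ℤ-Ring.solve-∀

-- u (x + (2i+1)(2j)) is both −u x and u x.
antiperiodic-odd-even⇒0 : ∀ u i j → Antiperiodic 0ℤ u (suc (2 * i)) → Antiperiodic 0ℤ u (2 * j) → ∀ x → u x ≡ 0ℤ
antiperiodic-odd-even⇒0 u i j anti-a anti-b x = 2i≡0⇒i≡0 (begin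
  u x ℤ.+ u x                             ≡⟨ cong (ℤ._+ u x) (Periodic-0⇒≡ u (Periodic-* u j (Antiperiodic⇒Periodic u anti-a)) x) ⟨
  u (x + j * (a + a)) ℤ.+ u x             ≡⟨ cong (λ y → u y ℤ.+ u x) (index x i j) ⟩
  u (x + b + i * (b + b)) ℤ.+ u x         ≡⟨ cong (ℤ._+ u x) (Periodic-0⇒≡ u (Periodic-* u i (Antiperiodic⇒Periodic u anti-b)) (x + b)) ⟩
  u (x + b) ℤ.+ u x                       ≡⟨ 0∣⇒≡0 (anti-b x) ⟩
  0ℤ                                      ∎)
  where
  open ≡-Reasoning
  a = suc (2 * i)
  b = 2 * j
  index : ∀ x i j → x + j * (suc (2 * i) + suc (2 * i)) ≡ x + 2 * j + i * (2 * j + 2 * j)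
  index = ℕ-Ring.solve-∀

-- Difference operators and sums along orbits of a shift.

Δ : ℕ → (ℕ → ℤ) → ℕ → ℤ
Δ s h x = h (x + s) ℤ.- h x

-- With T the shift, this is ((1 + T^p)(1 + T^q) h) x.
mixed : ℕ → ℕ → (ℕ → ℤ) → ℕ → ℤ
mixed p q h x = h x ℤ.+ h (x + p) ℤ.+ h (x + q) ℤ.+ h (x + (p + q))

-- T^(2pq) − 1 is a multiple of both 1 + T^p and 1 + T^q.
mixed-∣⇒Δ-Periodic : ∀ {d} p q (h : ℕ → ℤ) → (∀ x → d ℤᵈ.∣ mixed p q h x) →
                     Periodic d (Δ (q * (p + p)) h) (q * (p + p))
mixed-∣⇒Δ-Periodic {d} p q h d∣mixed =
  subst (Periodic d (Δ s h)) (index p q) (Periodic-* (Δ s h) p (Antiperiodic⇒Periodic (Δ s h) Δ-anti))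
  where
  s = q * (p + p)
  -- `w` is (1 + T^q) h, which 1 + T^p kills modulo `d`, so `w` has period s = q(2p). Since T^s - 1
  -- commutes with 1 + T^q, this says that `Δ s h` is antiperiodic under `q`, hence periodic under
  -- p(2q) = s.
  w : ℕ → ℤ
  w x = h (x + q) ℤ.+ h x
  index : ∀ p q → p * (q + q) ≡ q * (p + p)
  index = ℕ-Ring.solve-∀
  w-anti : Antiperiodic d w p
  w-anti x = subst (d ℤᵈ.∣_)
    (trans (ring (h x) _ _ _) (cong (λ y → (h y ℤ.+ h (x + p)) ℤ.+ w x) (sym (+-assoc x p q)))) (d∣mixed x)
    where
    ring : ∀ a b e f → a ℤ.+ b ℤ.+ e ℤ.+ f ≡ (f ℤ.+ b) ℤ.+ (e ℤ.+ a)
    ring = ℤ-Ring.solve-∀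
  Δ-anti : Antiperiodic d (Δ s h) q
  Δ-anti x = subst (d ℤᵈ.∣_)
    (trans (ring (h (x + s + q)) (h (x + s)) (h (x + q)) (h x)) (cong (λ y → (h y ℤ.- h (x + q)) ℤ.+ Δ s h x) (swap x s q)))
    (Periodic-* w q (Antiperiodic⇒Periodic w w-anti) x)
    where
    ring : ∀ a b e f → (a ℤ.+ b) ℤ.- (e ℤ.+ f) ≡ (a ℤ.- e) ℤ.+ (b ℤ.- f)
    ring = ℤ-Ring.solve-∀
    swap : ∀ x s q → x + s + q ≡ x + q + s
    swap = ℕ-Ring.solve-∀

-- As an operator this is 1 + T^t + ... + T^((m-1)t). It is evaluated in two ways: by telescoping on
-- a difference, and by periodicity modulo `d`.
orbitSum : ℕ → (ℕ → ℤ) → ℕ → ℕ → ℤ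
orbitSum t k zero    x = 0ℤ
orbitSum t k (suc m) x = k x ℤ.+ orbitSum t k m (x + t)

orbitSum-Δ : ∀ t h m x → orbitSum t (Δ t h) m x ≡ h (x + m * t) ℤ.- h x
orbitSum-Δ t h zero    x = sym (i≡j⇒i-j≡0 (cong h (+-identityʳ x)))
orbitSum-Δ t h (suc m) x = begin
  Δ t h x ℤ.+ orbitSum t (Δ t h) m (x + t)                       ≡⟨ cong (λ a → Δ t h x ℤ.+ a) (orbitSum-Δ t h m (x + t)) ⟩
  (h (x + t) ℤ.- h x) ℤ.+ (h (x + t + m * t) ℤ.- h (x + t))      ≡⟨ ring (h (x + t)) (h x) (h (x + t + m * t)) ⟩
  h (x + t + m * t) ℤ.- h x                                      ≡⟨ cong (λ y → h y ℤ.- h x) (+-assoc x t (m * t)) ⟩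
  h (x + (t + m * t)) ℤ.- h x                                    ∎
  where
  open ≡-Reasoning
  ring : ∀ a b e → (a ℤ.- b) ℤ.+ (e ℤ.- a) ≡ e ℤ.- b
  ring = ℤ-Ring.solve-∀

-- Modulo `d`, each of the `m` terms agrees with the first.
orbitSum-Periodic : ∀ {d t} u → Periodic d u t → ∀ m x → d ℤᵈ.∣ orbitSum t u m x ℤ.- + m ℤ.* u x
orbitSum-Periodic         u per zero    x = divides 0ℤ refl
orbitSum-Periodic {d} {t} u per (suc m) x = subst (d ℤᵈ.∣_) (ring (u x) (u (x + t)) (orbitSum t u m (x + t)) (+ m))
  (∣m∣n⇒∣m+n (orbitSum-Periodic u per m (x + t)) (ℤᵈ.∣n⇒∣m*n (+ m) (per x)))
  where
  ring : ∀ a b e f → (e ℤ.- f ℤ.* b) ℤ.+ f ℤ.* (b ℤ.- a) ≡ (a ℤ.+ e) ℤ.- (+ 1 ℤ.+ f) ℤ.* a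
  ring = ℤ-Ring.solve-∀

orbitSum-double : ∀ t k k′ → (∀ x → k x ≡ k′ x ℤ.* + 2) → ∀ m x → orbitSum t k m x ≡ orbitSum t k′ m x ℤ.* + 2
orbitSum-double t k k′ eq zero    x = refl
orbitSum-double t k k′ eq (suc m) x = trans (cong₂ ℤ._+_ (eq x) (orbitSum-double t k k′ eq m (x + t))) (ring (k′ x) (orbitSum t k′ m (x + t)))
  where
  ring : ∀ a b → a ℤ.* + 2 ℤ.+ b ℤ.* + 2 ≡ (a ℤ.+ b) ℤ.* + 2
  ring = ℤ-Ring.solve-∀

-- Unipotent operators of finite order are trivial.
Δ-Periodic⇒Periodic : ∀ {s} u n .{{_ : NonZero n}} → Periodic 0ℤ u n → Periodic 0ℤ (Δ s u) s → Periodic 0ℤ u s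
Δ-Periodic⇒Periodic {s} u n@(suc _) per-n per-s x =
  ℤᵈ.∣-reflexive (sym (fromInj₂ (λ ()) (i*j≡0⇒i≡0∨j≡0 (+ n) n*Δ≡0)))
  where
  -- The orbit sum of `Δ s u` telescopes to u (x + ns) - u x = 0, while its `n` terms are all equal;
  -- so n · Δ s u x = 0, and ℤ has no torsion.
  sum≡0 : orbitSum s (Δ s u) n x ≡ 0ℤ
  sum≡0 = trans (orbitSum-Δ s u n x)
    (subst (λ m → u (x + m) ℤ.- u x ≡ 0ℤ) (*-comm s n) (0∣⇒≡0 (Periodic-* u s per-n x)))
  n*Δ≡0 : + n ℤ.* Δ s u x ≡ 0ℤ
  n*Δ≡0 = trans (sym (i-j≡0⇒i≡j _ _ (0∣⇒≡0 (orbitSum-Periodic (Δ s u) per-s n x)))) sum≡0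

-- Descent at the prime 2, for the even part.

2∣odd*⇒2∣ : ∀ {m} i → ¬ (2 ∣ m) → + 2 ℤᵈ.∣ + m ℤ.* i → + 2 ℤᵈ.∣ i
2∣odd*⇒2∣ {m} i m-odd 2∣mi =
  ∣ᵤ⇒∣ (fromInj₂ (λ 2∣m → contradiction 2∣m m-odd)
    (euclidsLemma m ∣ i ∣ prime[2] (subst (2 ∣_) (abs-* (+ m) i) (∣⇒∣ᵤ 2∣mi))))

half-≤ : ∀ {b} a → a * 2 ≤ suc b → a ≤ b
half-≤ zero    _        = z≤n
half-≤ (suc a) (s≤s le) = ≤-trans (s≤s (m≤m*n a 2)) le

module Descent (p q c N : ℕ) (N-odd : ¬ (2 ∣ N)) where

  t : ℕ
  t = 2 * (q * (p + p))

  -- The properties of k = (T^t - 1) h that the descent uses. Both are linear and homogeneous, so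
  -- they survive exact division by 2.
  record Admissible (k : ℕ → ℤ) : Set where
    field
      mixed-eq : ∀ x → mixed p q k x ℤ.+ k (x + c) ℤ.* + 2 ≡ 0ℤ
      sum-eq   : ∀ x → orbitSum t k N x ≡ 0ℤ

  open Admissible

  -- Modulo 2 the term in `c` disappears, so (T^s - 1)² kills `k` for s = 2pq; and (T^s - 1)² ≡
  -- T^(2s) - 1 modulo 2. This is the source of the extra factor 2 in `t`.
  t-periodic-mod-2 : ∀ {k} → (∀ x → mixed p q k x ℤ.+ k (x + c) ℤ.* + 2 ≡ 0ℤ) → Periodic (+ 2) k t
  t-periodic-mod-2 {k} eqn x = subst (+ 2 ℤᵈ.∣_)
    (trans (ring (k (x + s + s)) (k (x + s)) (k x)) (cong (λ y → k y ℤ.- k x) (index x s)))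
    (∣m∣n⇒∣m+n (mixed-∣⇒Δ-Periodic p q k even x) (divides (Δ s k x) refl))
    where
    s = q * (p + p)
    index : ∀ x s → x + s + s ≡ x + 2 * s
    index = ℕ-Ring.solve-∀
    ring : ∀ a b e → ((a ℤ.- b) ℤ.- (b ℤ.- e)) ℤ.+ (b ℤ.- e) ℤ.* + 2 ≡ a ℤ.- e
    ring = ℤ-Ring.solve-∀
    ring₂ : ∀ a b → a ≡ (a ℤ.+ b ℤ.* + 2) ℤ.+ (ℤ.- b) ℤ.* + 2
    ring₂ = ℤ-Ring.solve-∀
    even : ∀ y → + 2 ℤᵈ.∣ mixed p q k y
    even y = divides (ℤ.- k (y + c)) (trans (ring₂ (mixed p q k y) (k (y + c)))
      (trans (cong (ℤ._+ (ℤ.- k (y + c)) ℤ.* + 2) (eqn y)) (+-identityˡ _)))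

  -- Modulo 2 the vanishing orbit sum consists of `N` copies of `k x`, and `N` is odd.
  admissible⇒even : ∀ {k} → Admissible k → ∀ x → + 2 ℤᵈ.∣ k x
  admissible⇒even {k} adm x = 2∣odd*⇒2∣ (k x) N-odd (subst (+ 2 ℤᵈ.∣_)
    (trans (cong (λ a → a ℤ.- (a ℤ.- + N ℤ.* k x)) (sum-eq adm x)) (ring _))
    (∣m∣n⇒∣m-n (divides 0ℤ (sum-eq adm x)) (orbitSum-Periodic k (t-periodic-mod-2 {k} (mixed-eq adm)) N x)))
    where
    ring : ∀ a → 0ℤ ℤ.- (0ℤ ℤ.- a) ≡ a
    ring = ℤ-Ring.solve-∀

  admissible-half : ∀ {k} k′ → (∀ x → k x ≡ k′ x ℤ.* + 2) → Admissible k → Admissible k′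
  admissible-half {k} k′ eq adm = record { mixed-eq = mixed-eq′ ; sum-eq = sum-eq′ }
    where
    sum-eq′ : ∀ x → orbitSum t k′ N x ≡ 0ℤ
    sum-eq′ x = *-cancelʳ-≡ _ 0ℤ (+ 2) (trans (sym (orbitSum-double t k k′ eq N x)) (sum-eq adm x))
    ring : ∀ a b e f g → (a ℤ.+ b ℤ.+ e ℤ.+ f ℤ.+ g ℤ.* + 2) ℤ.* + 2 ≡
           a ℤ.* + 2 ℤ.+ b ℤ.* + 2 ℤ.+ e ℤ.* + 2 ℤ.+ f ℤ.* + 2 ℤ.+ g ℤ.* + 2 ℤ.* + 2
    ring = ℤ-Ring.solve-∀
    mixed-double : ∀ x → mixed p q k x ≡
      k′ x ℤ.* + 2 ℤ.+ k′ (x + p) ℤ.* + 2 ℤ.+ k′ (x + q) ℤ.* + 2 ℤ.+ k′ (x + (p + q)) ℤ.* + 2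
    mixed-double x = cong₂ ℤ._+_ (cong₂ ℤ._+_ (cong₂ ℤ._+_ (eq x) (eq (x + p))) (eq (x + q))) (eq (x + (p + q)))
    mixed-eq′ : ∀ x → mixed p q k′ x ℤ.+ k′ (x + c) ℤ.* + 2 ≡ 0ℤ
    mixed-eq′ x = *-cancelʳ-≡ _ 0ℤ (+ 2)
      (trans (ring (k′ x) (k′ (x + p)) (k′ (x + q)) (k′ (x + (p + q))) (k′ (x + c)))
        (trans (sym (cong₂ (λ a b → a ℤ.+ b ℤ.* + 2) (mixed-double x) (eq (x + c)))) (mixed-eq adm x)))

  -- Infinite descent on the size of `k x` at a fixed `x`. The whole sequence is halved, since the
  -- equations relate different positions, but only the value at `x` needs a bound.
  admissible-bounded⇒0 : ∀ b {k} → Admissible k → ∀ x → ∣ k x ∣ ≤ b → k x ≡ 0ℤ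
  admissible-bounded⇒0 zero    adm x bound = ∣i∣≡0⇒i≡0 (n≤0⇒n≡0 bound)
  admissible-bounded⇒0 (suc b) {k} adm x bound =
    trans (eq x) (cong (ℤ._* + 2) (admissible-bounded⇒0 b adm′ x (half-≤ ∣ k′ x ∣ bound′)))
    where
    k′ : ℕ → ℤ
    k′ y = quotient (admissible⇒even adm y)
    eq : ∀ y → k y ≡ k′ y ℤ.* + 2
    eq y = ℤᵈ._∣_.equality (admissible⇒even adm y)
    adm′ : Admissible k′
    adm′ = admissible-half k′ eq adm
    bound′ : ∣ k′ x ∣ * 2 ≤ suc b
    bound′ = subst (_≤ suc b) (trans (cong ∣_∣ (eq x)) (abs-* (k′ x) (+ 2))) bound

  admissible⇒0 : ∀ {k} → Admissible k → ∀ x → k x ≡ 0ℤ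
  admissible⇒0 {k} adm x = admissible-bounded⇒0 ∣ k x ∣ adm x ≤-refl

  -- `Δ t h` is admissible: its mixed equation is the difference of those of `h` at y + t and y, and
  -- its orbit sum telescopes to h (y + Nt) - h y, which vanishes as `h` has period `N`.
  periodic : ∀ {h} → Periodic 0ℤ h N → (∀ x → mixed p q h x ℤ.+ h (x + c) ℤ.* + 2 ≡ 0ℤ) → Periodic 0ℤ h t
  periodic {h} per-N eqn x = ℤᵈ.∣-reflexive (sym (admissible⇒0 {Δ t h} (record { mixed-eq = Δ-mixed-eq ; sum-eq = Δ-sum-eq }) x))
    where
    Δ-sum-eq : ∀ y → orbitSum t (Δ t h) N y ≡ 0ℤ
    Δ-sum-eq y = trans (orbitSum-Δ t h N y)
      (subst (λ m → h (y + m) ℤ.- h y ≡ 0ℤ) (*-comm t N) (0∣⇒≡0 (Periodic-* h t per-N y)))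
    swap : ∀ y a b → y + a + b ≡ y + b + a
    swap = ℕ-Ring.solve-∀
    ring : ∀ a a′ b b′ e e′ f f′ g g′ →
      (a ℤ.- a′) ℤ.+ (b ℤ.- b′) ℤ.+ (e ℤ.- e′) ℤ.+ (f ℤ.- f′) ℤ.+ (g ℤ.- g′) ℤ.* + 2 ≡
      (a ℤ.+ b ℤ.+ e ℤ.+ f ℤ.+ g ℤ.* + 2) ℤ.- (a′ ℤ.+ b′ ℤ.+ e′ ℤ.+ f′ ℤ.+ g′ ℤ.* + 2)
    ring = ℤ-Ring.solve-∀
    Δ-mixed-eq : ∀ y → mixed p q (Δ t h) y ℤ.+ Δ t h (y + c) ℤ.* + 2 ≡ 0ℤ
    Δ-mixed-eq y rewrite swap y p t | swap y q t | swap y (p + q) t | swap y c t =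
      trans (ring (h (y + t)) (h y) (h (y + t + p)) (h (y + p)) (h (y + t + q)) (h (y + q))
                  (h (y + t + (p + q))) (h (y + (p + q))) (h (y + t + c)) (h (y + c)))
            (cong₂ ℤ._-_ (eqn (y + t)) (eqn y))

-- Splitting the labelling into odd and even parts under T^N.

module Core (p q c N : ℕ) (F : ℕ → ℤ)
            (F-periodic : ∀ x → F (x + (N + N)) ≡ F x)
            (F-eq : ∀ x → mixed p q F x ℤ.+ (F (x + c) ℤ.+ F (x + (c + N))) ≡ 0ℤ) where

  odd even : ℕ → ℤ
  odd  x = F x ℤ.- F (x + N)
  even x = F x ℤ.+ F (x + N)

  private
    index-N : ∀ x a → x + a + N ≡ x + N + a
    index-N x a = swap x a N
      where
      swap : ∀ x a b → x + a + b ≡ x + b + a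
      swap = ℕ-Ring.solve-∀

    F-periodic′ : ∀ x → F (x + N + N) ≡ F x
    F-periodic′ x = trans (cong F (+-assoc x N N)) (F-periodic x)

    F-eq′ : ∀ x → mixed p q F x ℤ.+ (F (x + c) ℤ.+ F (x + c + N)) ≡ 0ℤ
    F-eq′ x = trans (cong (λ y → mixed p q F x ℤ.+ (F (x + c) ℤ.+ F y)) (+-assoc x c N)) (F-eq x)

    -- Translating by `N` exchanges the two terms at x + c and x + c + N. Subtracting this from
    -- `F-eq′` therefore cancels them, which gives `mixed-odd`; adding doubles them, which gives
    -- `mixed-even`.
    F-eq″ : ∀ x → mixed p q F (x + N) ℤ.+ (F (x + c + N) ℤ.+ F (x + c)) ≡ 0ℤ
    F-eq″ x = begin
      mixed p q F (x + N) ℤ.+ (F (x + c + N) ℤ.+ F (x + c))           ≡⟨ cong₂ (λ a b → mixed p q F (x + N) ℤ.+ (a ℤ.+ b)) (cong F (index-N x c)) (sym (F-periodic′ (x + c))) ⟩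
      mixed p q F (x + N) ℤ.+ (F (x + N + c) ℤ.+ F (x + c + N + N))   ≡⟨ cong (λ y → mixed p q F (x + N) ℤ.+ (F (x + N + c) ℤ.+ F (y + N))) (index-N x c) ⟩
      mixed p q F (x + N) ℤ.+ (F (x + N + c) ℤ.+ F (x + N + c + N))   ≡⟨ F-eq′ (x + N) ⟩
      0ℤ                                                              ∎
      where open ≡-Reasoning

  odd-antiperiodic : Antiperiodic 0ℤ odd N
  odd-antiperiodic x = divides 0ℤ (trans (cong (λ a → (F (x + N) ℤ.- a) ℤ.+ odd x) (F-periodic′ x)) (ring (F x) (F (x + N))))
    where
    ring : ∀ a b → (b ℤ.- a) ℤ.+ (a ℤ.- b) ≡ 0ℤ
    ring = ℤ-Ring.solve-∀

  even-periodic : Periodic 0ℤ even N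
  even-periodic x = divides 0ℤ (trans (cong (λ a → (F (x + N) ℤ.+ a) ℤ.- even x) (F-periodic′ x)) (ring (F x) (F (x + N))))
    where
    ring : ∀ a b → (b ℤ.+ a) ℤ.- (a ℤ.+ b) ≡ 0ℤ
    ring = ℤ-Ring.solve-∀

  mixed-odd : ∀ x → mixed p q odd x ≡ 0ℤ
  mixed-odd x rewrite index-N x p | index-N x q | index-N x (p + q) =
    trans (ring (F x) (F (x + N)) (F (x + p)) (F (x + N + p)) (F (x + q)) (F (x + N + q))
                (F (x + (p + q))) (F (x + N + (p + q))) (F (x + c)) (F (x + c + N)))
          (cong₂ ℤ._-_ (F-eq′ x) (F-eq″ x))
    where
    ring : ∀ a a′ b b′ e e′ f f′ y z →
      (a ℤ.- a′) ℤ.+ (b ℤ.- b′) ℤ.+ (e ℤ.- e′) ℤ.+ (f ℤ.- f′) ≡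
      (a ℤ.+ b ℤ.+ e ℤ.+ f ℤ.+ (y ℤ.+ z)) ℤ.- (a′ ℤ.+ b′ ℤ.+ e′ ℤ.+ f′ ℤ.+ (z ℤ.+ y))
    ring = ℤ-Ring.solve-∀

  mixed-even : ∀ x → mixed p q even x ℤ.+ even (x + c) ℤ.* + 2 ≡ 0ℤ
  mixed-even x rewrite index-N x p | index-N x q | index-N x (p + q) =
    trans (ring (F x) (F (x + N)) (F (x + p)) (F (x + N + p)) (F (x + q)) (F (x + N + q))
                (F (x + (p + q))) (F (x + N + (p + q))) (F (x + c)) (F (x + c + N)))
          (cong₂ ℤ._+_ (F-eq′ x) (F-eq″ x))
    where
    ring : ∀ a a′ b b′ e e′ f f′ y z →
      (a ℤ.+ a′) ℤ.+ (b ℤ.+ b′) ℤ.+ (e ℤ.+ e′) ℤ.+ (f ℤ.+ f′) ℤ.+ (y ℤ.+ z) ℤ.* + 2 ≡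
      (a ℤ.+ b ℤ.+ e ℤ.+ f ℤ.+ (y ℤ.+ z)) ℤ.+ (a′ ℤ.+ b′ ℤ.+ e′ ℤ.+ f′ ℤ.+ (z ℤ.+ y))
    ring = ℤ-Ring.solve-∀

  -- The clash between an odd and an even antiperiod is used twice: (1 + T^q) `odd` has antiperiods
  -- `p` and `N`, so it vanishes; then `odd` itself has antiperiods `q` and `N`, so it vanishes too.
  N-even⇒half-period : ∀ i i′ j → p ≡ suc (2 * i) → q ≡ suc (2 * i′) → N ≡ 2 * j → ∀ x → F (x + N) ≡ F x
  N-even⇒half-period i i′ j refl refl refl x = sym (i-j≡0⇒i≡j _ _ (antiperiodic-odd-even⇒0 odd i′ j odd-q odd-antiperiodic x))
    where
    w : ℕ → ℤ
    w y = odd (y + q) ℤ.+ odd y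
    w-p : Antiperiodic 0ℤ w p
    w-p y = divides 0ℤ (trans (cong (λ z → (odd z ℤ.+ odd (y + p)) ℤ.+ w y) (+-assoc y p q))
      (trans (ring (odd y) (odd (y + p)) (odd (y + q)) (odd (y + (p + q)))) (mixed-odd y)))
      where
      ring : ∀ a b e f → (f ℤ.+ b) ℤ.+ (e ℤ.+ a) ≡ a ℤ.+ b ℤ.+ e ℤ.+ f
      ring = ℤ-Ring.solve-∀
    w-N : Antiperiodic 0ℤ w N
    w-N y = divides 0ℤ (trans (cong (λ z → (odd z ℤ.+ odd (y + N)) ℤ.+ w y) (sym (index-N y q)))
      (trans (ring (odd y) (odd (y + N)) (odd (y + q)) (odd (y + q + N)))
        (cong₂ ℤ._+_ (0∣⇒≡0 (odd-antiperiodic (y + q))) (0∣⇒≡0 (odd-antiperiodic y)))))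
      where
      ring : ∀ a b e f → (f ℤ.+ b) ℤ.+ (e ℤ.+ a) ≡ (f ℤ.+ e) ℤ.+ (b ℤ.+ a)
      ring = ℤ-Ring.solve-∀
    odd-q : Antiperiodic 0ℤ odd q
    odd-q y = divides 0ℤ (antiperiodic-odd-even⇒0 w i j w-p w-N y)

  -- 2 (F (x + t) - F x) is the sum of the differences of `odd` and `even` over `t`, and both of
  -- these are zero.
  N-odd⇒period : .{{_ : NonZero (N + N)}} → ¬ (2 ∣ N) → ∀ x → F (x + 2 * (q * (p + p))) ≡ F x
  N-odd⇒period N-odd x = i-j≡0⇒i≡j _ _ (2i≡0⇒i≡0 (trans
    (ring (F (x + t)) (F (x + t + N)) (F x) (F (x + N)))
    (cong₂ ℤ._+_ (0∣⇒≡0 (odd-t x)) (0∣⇒≡0 (Descent.periodic p q c N N-odd {even} even-periodic mixed-even x)))))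
    where
    s t : ℕ
    s = q * (p + p)
    t = 2 * s
    ring : ∀ a a′ b b′ → (a ℤ.- b) ℤ.+ (a ℤ.- b) ≡
      ((a ℤ.- a′) ℤ.- (b ℤ.- b′)) ℤ.+ ((a ℤ.+ a′) ℤ.- (b ℤ.+ b′))
    ring = ℤ-Ring.solve-∀
    -- Antiperiodicity under `N` gives `odd` the period 2N, so T has finite order on it and the
    -- unipotence argument yields period s; doubling reaches `t`.
    odd-t : Periodic 0ℤ odd t
    odd-t = Periodic-* odd 2 (Δ-Periodic⇒Periodic odd (N + N)
      (Antiperiodic⇒Periodic odd odd-antiperiodic)
      (mixed-∣⇒Δ-Periodic p q odd (λ y → divides 0ℤ (mixed-odd y))))

-- Residues modulo `n` and translation.

module _ {n : ℕ} .{{_ : NonZero n}} where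

  []-congˡ-+ : ∀ {a b} k → [_] {n} a ≡ [ b ] → [_] {n} (a + k) ≡ [ b + k ]
  []-congˡ-+ {a} {b} k eq = toℕ-injective (begin
    toℕ ([_] {n} (a + k))                  ≡⟨ toℕ-[] (a + k) ⟩
    (a + k) % n                            ≡⟨ []-+ a k ⟨
    (toℕ ([_] {n} a) + toℕ ([_] {n} k)) % n  ≡⟨ cong (λ z → (toℕ z + toℕ ([_] {n} k)) % n) eq ⟩
    (toℕ ([_] {n} b) + toℕ ([_] {n} k)) % n  ≡⟨ []-+ b k ⟩
    (b + k) % n                            ≡⟨ toℕ-[] (b + k) ⟨
    toℕ ([_] {n} (b + k))                  ∎)
    where open ≡-Reasoning

  [+n] : ∀ a → [_] {n} (a + n) ≡ [ a ]
  [+n] a = toℕ-injective (trans (toℕ-[] (a + n)) (trans ([m+n]%n≡m%n a n) (sym (toℕ-[] a))))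

  [toℕ+] : ∀ a k → [_] {n} (toℕ ([_] {n} a) + k) ≡ [ a + k ]
  [toℕ+] a k = []-congˡ-+ k ([]-toℕ [ a ])

  toℕ-[]-< : ∀ {k} → k < n → toℕ ([_] {n} k) ≡ k
  toℕ-[]-< {k} k<n = trans (toℕ-[] k) (m<n⇒m%n≡m k<n)

  []-injective-< : ∀ {a b} → a < n → b < n → [_] {n} a ≡ [ b ] → a ≡ b
  []-injective-< a<n b<n eq = trans (sym (toℕ-[]-< a<n)) (trans (cong toℕ eq) (toℕ-[]-< b<n))

  neg-[] : ∀ {k} → k < n → neg ([_] {n} k) ≡ [ n ∸ k ]
  neg-[] k<n = cong (λ z → [ n ∸ z ]) (toℕ-[]-< k<n)

  ⊖≡[]⇒≡ : ∀ {u v : Fin n} k → v ⊖ u ≡ [ k ] → v ≡ [ toℕ u + k ]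
  ⊖≡[]⇒≡ {u} {v} k eq = begin
    v                                          ≡⟨ []-toℕ v ⟨
    [ toℕ v ]                                  ≡⟨ [+n] (toℕ v) ⟨
    [ toℕ v + n ]                              ≡⟨ cong (λ z → [ toℕ v + z ]) (m∸n+n≡m (<⇒≤ (toℕ<n u))) ⟨
    [ toℕ v + (n ∸ toℕ u + toℕ u) ]            ≡⟨ cong [_] (+-assoc (toℕ v) (n ∸ toℕ u) (toℕ u)) ⟨
    [ toℕ v + (n ∸ toℕ u) + toℕ u ]            ≡⟨ []-congˡ-+ (toℕ u) eq ⟩
    [ k + toℕ u ]                              ≡⟨ cong [_] (+-comm k (toℕ u)) ⟩
    [ toℕ u + k ]                              ∎
    where open ≡-Reasoning

  [+]⊖ : ∀ (u : Fin n) k → [ toℕ u + k ] ⊖ u ≡ [ k ]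
  [+]⊖ u k = begin
    [ toℕ ([_] {n} (toℕ u + k)) + (n ∸ toℕ u) ]  ≡⟨ [toℕ+] (toℕ u + k) (n ∸ toℕ u) ⟩
    [ toℕ u + k + (n ∸ toℕ u) ]                  ≡⟨ cong (λ z → [ z + (n ∸ toℕ u) ]) (+-comm (toℕ u) k) ⟩
    [ k + toℕ u + (n ∸ toℕ u) ]                  ≡⟨ cong [_] (+-assoc k (toℕ u) (n ∸ toℕ u)) ⟩
    [ k + (toℕ u + (n ∸ toℕ u)) ]                ≡⟨ cong (λ z → [ k + z ]) (m+[n∸m]≡n (<⇒≤ (toℕ<n u))) ⟩
    [ k + n ]                                    ≡⟨ [+n] k ⟩
    [ k ]                                        ∎
    where open ≡-Reasoning

  translate-injective-< : ∀ (u : Fin n) {a b} → a < n → b < n → [_] {n} (toℕ u + a) ≡ [ toℕ u + b ] → a ≡ b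
  translate-injective-< u {a} {b} a<n b<n eq =
    []-injective-< a<n b<n (trans (sym ([+]⊖ u a)) (trans (cong (_⊖ u) eq) ([+]⊖ u b)))

half+half : ∀ {n} → 2 ∣ n → n / 2 + n / 2 ≡ n
half+half {n} 2∣n = trans (ring (n / 2)) (m/n*n≡m 2∣n)
  where
  ring : ∀ a → a + a ≡ a * 2
  ring = ℕ-Ring.solve-∀

-- Closed neighbourhoods as lists of translates.

module _ (n : ℕ) .{{_ : NonZero n}} (c : ℕ) (2∣n : 2 ∣ n) (1<c : 1 < c) (c<n/2 : c < n / 2) where

  private
    c<n : c < n
    c<n = <-trans c<n/2 (subst (n / 2 <_) (half+half 2∣n) (m<m+n (n / 2) (<-trans (<-trans (s≤s z≤n) 1<c) c<n/2)))

    1<n : 1 < n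
    1<n = <-trans 1<c c<n

  -- The elements 0, 1, c, n/2, −c, −1 of ℤₙ as increasing residues.
  offsets : List ℕ
  offsets = 0 ∷ 1 ∷ c ∷ n / 2 ∷ n ∸ c ∷ n ∸ 1 ∷ []

  private
    -- The bound by `n` makes distinct offsets distinct residues. The relation is transitive, so
    -- comparing consecutive offsets is enough.
    _<ₙ_ : ℕ → ℕ → Set
    a <ₙ b = a < b × b < n

    offsets-increasing : Linked _<ₙ_ offsets
    offsets-increasing =
      (s≤s z≤n , 1<n) ∷ (1<c , c<n) ∷ (c<n/2 , <-trans n/2<n∸c n∸c<n) ∷ (n/2<n∸c , n∸c<n) ∷
      (∸-monoʳ-< 1<c (<⇒≤ c<n) , n∸1<n) ∷ [-]
      where
      n∸1<n : n ∸ 1 < n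
      n∸1<n = ∸-monoʳ-< (s≤s z≤n) (<⇒≤ 1<n)
      n∸c<n : n ∸ c < n
      n∸c<n = ∸-monoʳ-< (<-trans (s≤s z≤n) 1<c) (<⇒≤ c<n)
      n/2<n∸c : n / 2 < n ∸ c
      n/2<n∸c = m+n≤o⇒m≤o∸n (suc (n / 2)) (subst (n / 2 + c <_) (half+half 2∣n) (+-monoʳ-< (n / 2) c<n/2))

    Γ : Graph n
    Γ = CayConnectionSet n c 2∣n 1<c c<n/2

    translates : Fin n → List (Fin n)
    translates u = map (λ k → [ toℕ u + k ]) offsets

    translates-unique : ∀ u → Unique (translates u)
    translates-unique u = AllPairs-map⁺ (AllPairs.map
      (λ (a<b , b<n) eq → <⇒≢ a<b (translate-injective-< u (<-trans a<b b<n) b<n eq))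
      (Linked⇒AllPairs (λ (a<b , _) (b<c , c<n) → <-trans a<b b<c , c<n) offsets-increasing))

    neighbour⇒translate : ∀ u {v} → u ≡ v ⊎ (v ⊖ u) ∈ˢ connectionSet n c → v ∈ translates u
    neighbour⇒translate u (inj₁ refl) = here (trans (sym ([]-toℕ u)) (cong [_] (sym (+-identityʳ (toℕ u)))))
    neighbour⇒translate u (inj₂ v⊖u∈) with x∈p∪q⁻ ⁅ [ 1 ] ⁆ _ v⊖u∈
    ... | inj₁ ∈₁ = there (here (⊖≡[]⇒≡ 1 (x∈⁅y⁆⇒x≡y _ ∈₁)))
    ... | inj₂ ∈ʳ with x∈p∪q⁻ ⁅ neg [ 1 ] ⁆ _ ∈ʳ
    ...   | inj₁ ∈₂ = there (there (there (there (there (here (⊖≡[]⇒≡ (n ∸ 1) (trans (x∈⁅y⁆⇒x≡y _ ∈₂) (neg-[] 1<n))))))))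
    ...   | inj₂ ∈ʳ′ with x∈p∪q⁻ ⁅ [ c ] ⁆ _ ∈ʳ′
    ...     | inj₁ ∈₃ = there (there (here (⊖≡[]⇒≡ c (x∈⁅y⁆⇒x≡y _ ∈₃))))
    ...     | inj₂ ∈ʳ″ with x∈p∪q⁻ ⁅ neg [ c ] ⁆ _ ∈ʳ″
    ...       | inj₁ ∈₄ = there (there (there (there (here (⊖≡[]⇒≡ (n ∸ c) (trans (x∈⁅y⁆⇒x≡y _ ∈₄) (neg-[] c<n)))))))
    ...       | inj₂ ∈₅ = there (there (there (here (⊖≡[]⇒≡ (n / 2) (x∈⁅y⁆⇒x≡y _ ∈₅)))))

    translate⇒neighbour : ∀ u {v} → v ∈ translates u → u ≡ v ⊎ (v ⊖ u) ∈ˢ connectionSet n c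
    translate⇒neighbour u (here refl) = inj₁ (trans (sym ([]-toℕ u)) (cong [_] (sym (+-identityʳ (toℕ u)))))
    translate⇒neighbour u (there (here refl)) =
      inj₂ (x∈p∪q⁺ (inj₁ (subst (_∈ˢ ⁅ [ 1 ] ⁆) (sym ([+]⊖ u 1)) (x∈⁅x⁆ _))))
    translate⇒neighbour u (there (there (here refl))) =
      inj₂ (x∈p∪q⁺ (inj₂ (x∈p∪q⁺ (inj₂ (x∈p∪q⁺ (inj₁ (subst (_∈ˢ ⁅ [ c ] ⁆) (sym ([+]⊖ u c)) (x∈⁅x⁆ _))))))))
    translate⇒neighbour u (there (there (there (here refl)))) =
      inj₂ (x∈p∪q⁺ (inj₂ (x∈p∪q⁺ (inj₂ (x∈p∪q⁺ (inj₂ (x∈p∪q⁺ (inj₂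
        (subst (_∈ˢ ⁅ [ n / 2 ] ⁆) (sym ([+]⊖ u (n / 2))) (x∈⁅x⁆ _))))))))))
    translate⇒neighbour u (there (there (there (there (here refl))))) =
      inj₂ (x∈p∪q⁺ (inj₂ (x∈p∪q⁺ (inj₂ (x∈p∪q⁺ (inj₂ (x∈p∪q⁺ (inj₁
        (subst (_∈ˢ ⁅ neg [ c ] ⁆) (sym (trans ([+]⊖ u (n ∸ c)) (sym (neg-[] c<n)))) (x∈⁅x⁆ _))))))))))
    translate⇒neighbour u (there (there (there (there (there (here refl)))))) =
      inj₂ (x∈p∪q⁺ (inj₂ (x∈p∪q⁺ (inj₁
        (subst (_∈ˢ ⁅ neg [ 1 ] ⁆) (sym (trans ([+]⊖ u (n ∸ 1)) (sym (neg-[] 1<n)))) (x∈⁅x⁆ _))))))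

  -- Both lists are free of repetitions and have the same members, so they agree as multisets, which
  -- is what a sum of labels requires.
  closedNeighbourhood-↭ : ∀ u → closedNeighbourhood Γ u ↭ map (λ k → [ toℕ u + k ]) offsets
  closedNeighbourhood-↭ u = ∼bag⇒↭ (unique∧set⇒bag (filter⁺ _ (allFin⁺ n)) (translates-unique u)
    (mk⇔ (λ v∈ → neighbour⇒translate u (proj₂ (∈-filter⁻ _ {xs = allFin n} v∈)))
         (λ v∈ → ∈-filter⁺ _ (∈-allFin _) (translate⇒neighbour u v∈))))

-- The centred labelling and its recurrence.

module Labelling (n : ℕ) .{{_ : NonZero n}} (p : ℕ) (2∣n : 2 ∣ n) (1<c : 1 < suc p) (c<n/2 : suc p < n / 2)
                 (ℓ : Fin n ⤖ Fin n) (r : ℕ)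
                 (magic : ∀ u → sum (map (label ℓ) (closedNeighbourhood (CayConnectionSet n (suc p) 2∣n 1<c c<n/2) u)) ≡ r) where

  c q N : ℕ
  c = suc p
  q = suc (suc p)
  N = n / 2

  L : ℕ → ℕ
  L x = label ℓ [ x ]

  L-injective : ∀ {x y} → L x ≡ L y → [_] {n} x ≡ [ y ]
  L-injective eq = Bijection.injective ℓ (toℕ-injective (suc-injective eq))

  L-periodic : ∀ x → L (x + n) ≡ L x
  L-periodic x = cong (label ℓ) ([+n] x)

  L-magic : ∀ x → sum (map (λ k → L (x + k)) (offsets n c 2∣n 1<c c<n/2)) ≡ r
  L-magic x = trans
    (cong sum (trans (map-cong shift (offsets n c 2∣n 1<c c<n/2))
      (map-∘ {g = label ℓ} {f = λ k → [ toℕ ([_] {n} x) + k ]} (offsets n c 2∣n 1<c c<n/2))))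
    (trans (sym (sum-↭ (↭-map⁺ (label ℓ) (closedNeighbourhood-↭ n c 2∣n 1<c c<n/2 [ x ])))) (magic [ x ]))
    where
    shift : ∀ k → L (x + k) ≡ label ℓ [ toℕ ([_] {n} x) + k ]
    shift k = cong (label ℓ) (sym ([toℕ+] x k))

  -- Centred, so that the magic constant becomes 0 (closed neighbourhoods have 6 elements).
  F : ℕ → ℤ
  F x = + 6 ℤ.* + L x ℤ.- + r

  F-injective : ∀ {x y} → F x ≡ F y → [_] {n} x ≡ [ y ]
  F-injective {x} {y} eq = L-injective (+-injective (*-cancelˡ-≡ (+ 6) (+ L x) (+ L y) (+-cancelʳ (ℤ.- + r) _ _ eq)))

  F-periodic-n : ∀ x → F (x + n) ≡ F x
  F-periodic-n x = cong (λ a → + 6 ℤ.* + a ℤ.- + r) (L-periodic x)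

  F-periodic : ∀ x → F (x + (N + N)) ≡ F x
  F-periodic x = trans (cong (λ m → F (x + m)) (half+half 2∣n)) (F-periodic-n x)

  F-magic : ∀ x → F (x + 0) ℤ.+ F (x + 1) ℤ.+ F (x + c) ℤ.+ F (x + N) ℤ.+ F (x + (n ∸ c)) ℤ.+ F (x + (n ∸ 1)) ≡ 0ℤ
  F-magic x = trans
    (ring (+ L (x + 0)) (+ L (x + 1)) (+ L (x + c)) (+ L (x + N)) (+ L (x + (n ∸ c))) (+ L (x + (n ∸ 1))) (+ r))
    (trans (cong (λ a → + 6 ℤ.* + a ℤ.- + 6 ℤ.* + r) (L-magic x)) (+-inverseʳ (+ 6 ℤ.* + r)))
    where
    ring : ∀ a b e f g h s →
      (+ 6 ℤ.* a ℤ.- s) ℤ.+ (+ 6 ℤ.* b ℤ.- s) ℤ.+ (+ 6 ℤ.* e ℤ.- s) ℤ.+ (+ 6 ℤ.* f ℤ.- s) ℤ.+ (+ 6 ℤ.* g ℤ.- s) ℤ.+ (+ 6 ℤ.* h ℤ.- s)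
      ≡ + 6 ℤ.* (a ℤ.+ (b ℤ.+ (e ℤ.+ (f ℤ.+ (g ℤ.+ (h ℤ.+ + 0)))))) ℤ.- + 6 ℤ.* s
    ring = ℤ-Ring.solve-∀

  -- This is the magic condition at y = x + c: the offsets 0, 1, c, N, -c, -1 from `y` lead to x +
  -- c, x + q, x + (p + q), x + (c + N), x and x + p, since p + q = 2c.
  F-eq : ∀ x → mixed p q F x ℤ.+ (F (x + c) ℤ.+ F (x + (c + N))) ≡ 0ℤ
  F-eq x = begin
    mixed p q F x ℤ.+ (F (x + c) ℤ.+ F (x + (c + N)))
      ≡⟨ ring (F x) (F (x + p)) (F (x + q)) (F (x + (p + q))) (F (x + c)) (F (x + (c + N))) ⟩
    F (x + c) ℤ.+ F (x + q) ℤ.+ F (x + (p + q)) ℤ.+ F (x + (c + N)) ℤ.+ F x ℤ.+ F (x + p)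
      ≡⟨ cong₂ ℤ._+_ (cong₂ ℤ._+_ (cong₂ ℤ._+_ (cong₂ ℤ._+_ (cong₂ ℤ._+_
           (cong F (i₁ x p)) (cong F (i₂ x p))) (cong F (i₃ x p))) (cong F (i₄ x p N))) F₅) F₆ ⟩
    F (y + 0) ℤ.+ F (y + 1) ℤ.+ F (y + c) ℤ.+ F (y + N) ℤ.+ F (y + (n ∸ c)) ℤ.+ F (y + (n ∸ 1))
      ≡⟨ F-magic y ⟩
    0ℤ ∎
    where
    open ≡-Reasoning
    y = x + c
    c<n : c < n
    c<n = <-≤-trans c<n/2 (subst (N ≤_) (half+half 2∣n) (m≤m+n N N))
    ring : ∀ a b e f g h → a ℤ.+ b ℤ.+ e ℤ.+ f ℤ.+ (g ℤ.+ h) ≡ g ℤ.+ e ℤ.+ f ℤ.+ h ℤ.+ a ℤ.+ b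
    ring = ℤ-Ring.solve-∀
    i₁ : ∀ x p → x + suc p ≡ x + suc p + 0
    i₁ = ℕ-Ring.solve-∀
    i₂ : ∀ x p → x + suc (suc p) ≡ x + suc p + 1
    i₂ = ℕ-Ring.solve-∀
    i₃ : ∀ x p → x + (p + suc (suc p)) ≡ x + suc p + suc p
    i₃ = ℕ-Ring.solve-∀
    i₄ : ∀ x p m → x + (suc p + m) ≡ x + suc p + m
    i₄ = ℕ-Ring.solve-∀
    i₆ : ∀ x p m → x + suc p + m ≡ x + p + suc m
    i₆ = ℕ-Ring.solve-∀
    F₅ : F x ≡ F (y + (n ∸ c))
    F₅ = sym (trans (cong F (trans (+-assoc x c (n ∸ c)) (cong (λ z → x + z) (m+[n∸m]≡n (<⇒≤ c<n))))) (F-periodic-n x))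
    F₆ : F (x + p) ≡ F (y + (n ∸ 1))
    F₆ = sym (trans (cong F (trans (i₆ x p (n ∸ 1)) (cong (λ z → x + p + z) (m+[n∸m]≡n (<⇒≤ (<-trans 1<c c<n)))))) (F-periodic-n (x + p)))

  open Core p q c N F F-periodic F-eq public using (N-even⇒half-period; N-odd⇒period)

-- Parity, and the divisibility conclusion.

¬2∣1 : ¬ (2 ∣ 1)
¬2∣1 2∣1 with () ← ∣1⇒≡1 2∣1

2∣suc⇒2∤ : ∀ {m} → 2 ∣ suc m → ¬ (2 ∣ m)
2∣suc⇒2∤ {m} 2∣1+m 2∣m = ¬2∣1 (∣m+n∣m⇒∣n (subst (2 ∣_) (+-comm 1 m) 2∣1+m) 2∣m)

2∣c⇒2∤[c+1][c-1] : ∀ {m} → 2 ∣ suc m → ¬ (2 ∣ suc (suc m) * m)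
2∣c⇒2∤[c+1][c-1] {m} 2∣c 2∣product with euclidsLemma (suc (suc m)) m prime[2] 2∣product
... | inj₁ 2∣c+1 = 2∣suc⇒2∤ 2∣c+1 2∣c
... | inj₂ 2∣c-1 = 2∣suc⇒2∤ 2∣c 2∣c-1

odd⇒coprime-2 : ∀ {m} → ¬ (2 ∣ m) → Coprime m 2
odd⇒coprime-2 m-odd (d∣m , d∣2) with irreducible[2] d∣2
... | inj₁ d≡1  = d≡1
... | inj₂ refl = contradiction d∣m m-odd

odd⇒2*≡2-mod-4 : ∀ {m} → ¬ (2 ∣ m) → (m + m) % 4 ≡ 2
odd⇒2*≡2-mod-4 {m} m-odd with m % 2 in eq | m%n<n m 2
... | 0           | _ = contradiction (m%n≡0⇒n∣m m 2 eq) m-odd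
... | 1           | _ = trans (cong (_% 4) m+m≡) ([m+kn]%n≡m%n 2 (m / 2) 4)
  where
  ring : ∀ a → (1 + a * 2) + (1 + a * 2) ≡ 2 + a * 4
  ring = ℕ-Ring.solve-∀
  m≡ : m ≡ 1 + m / 2 * 2
  m≡ = trans (m≡m%n+[m/n]*n m 2) (cong (_+ m / 2 * 2) eq)
  m+m≡ : m + m ≡ 2 + m / 2 * 4
  m+m≡ = trans (cong₂ _+_ m≡ m≡) (ring (m / 2))
... | suc (suc _) | s≤s (s≤s ())

proposition4p8 : (n : ℕ) .{{_ : NonZero n}} (c : ℕ) →
    6 ≤ n → (2∣n : 2 ∣ n) (1<c : 1 < c) (c<n/2 : c < n / 2) →
    ClosedDistanceMagic (CayConnectionSet n c 2∣n 1<c c<n/2) →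
    (∃[ j ] Type2 n c j) →
    2 ∣ c →
    ∃[ c′ ] Σ[ 1<c′ ∈ 1 < c′ ] Σ[ c′<n/2 ∈ c′ < n / 2 ]
    (CayConnectionSet n c 2∣n 1<c c<n/2 ≅ CayConnectionSet n c′ 2∣n 1<c′ c′<n/2) ×
    n % 4 ≡ 2 ×
    2 ∣ c′ ×
    (∃[ m ] (¬ (2 ∣ m)) × 2 * (c′ * c′ ∸ 1) ≡ m * n)
proposition4p8 n c@(suc p) _ 2∣n 1<c c<n/2 (ℓ , r , _ , magic) _ 2∣c@(divides (suc i) c≡2+2i) =
  c , 1<c , c<n/2 ,
  (⤖-id _ , λ _ _ → ⇔-id _) ,
  subst (λ a → a % 4 ≡ 2) N+N≡n (odd⇒2*≡2-mod-4 N-odd) ,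
  2∣c ,
  m , m-odd , 2[c²-1]≡mn
  where
  open Labelling n p 2∣n 1<c c<n/2 ℓ r magic using (N; q; F-injective; N-even⇒half-period; N-odd⇒period)

  N+N≡n : N + N ≡ n
  N+N≡n = half+half 2∣n

  0<N : 0 < N
  0<N = <-trans (s≤s z≤n) c<n/2

  N<n : N < n
  N<n = subst (N <_) N+N≡n (m<m+n N 0<N)

  p≡1+2i : p ≡ suc (2 * i)
  p≡1+2i = suc-injective (trans c≡2+2i (ring i))
    where
    ring : ∀ a → suc a * 2 ≡ suc (suc (2 * a))
    ring = ℕ-Ring.solve-∀

  q≡1+2[1+i] : q ≡ suc (2 * suc i)
  q≡1+2[1+i] = cong suc (trans c≡2+2i (*-comm (suc i) 2))

  N-odd : ¬ (2 ∣ N)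
  -- For even `N`, `F` takes equal values at `N` and 0, so these would be the same residue although
  -- 0 < N < n.
  N-odd (divides j N≡j*2) = <⇒≢ 0<N (sym ([]-injective-< N<n (<-trans 0<N N<n)
    (F-injective (N-even⇒half-period i (suc i) j p≡1+2i q≡1+2[1+i] (trans N≡j*2 (*-comm j 2)) 0))))

  n∣4pq : n ∣ 2 * (q * (p + p))
  n∣4pq = m%n≡0⇒n∣m _ n (trans (sym (toℕ-[] _)) (trans (cong toℕ (F-injective {2 * (q * (p + p))} {0}
    (N-odd⇒period {{>-nonZero (<-trans 0<N (m<m+n N 0<N))}} N-odd 0))) (toℕ-[0] {n})))

  N∣pq : N ∣ q * p
  -- Cancelling 2 from 2N ∣ 4pq leaves N ∣ 2pq, and `N` is coprime to 2.
  N∣pq = coprime-divisor (odd⇒coprime-2 N-odd)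
    (*-cancelʳ-∣ 2 (subst (_∣ 2 * (q * p) * 2) (sym (m/n*n≡m 2∣n)) (subst (n ∣_) (ring q p) n∣4pq)))
    where
    ring : ∀ a b → 2 * (a * (b + b)) ≡ 2 * (a * b) * 2
    ring = ℕ-Ring.solve-∀

  m : ℕ
  m = _∣_.quotient N∣pq

  qp≡mN : q * p ≡ m * N
  qp≡mN = _∣_.equality N∣pq

  m-odd : ¬ (2 ∣ m)
  -- An even `m` would make `q * p` even, but `q` and `p` are the neighbours of the even number `c`.
  m-odd 2∣m = 2∣c⇒2∤[c+1][c-1] 2∣c (subst (2 ∣_) (sym qp≡mN) (∣m⇒∣m*n N 2∣m))

  2[c²-1]≡mn : 2 * (c * c ∸ 1) ≡ m * n
  2[c²-1]≡mn = begin
    -- With c = `suc p`, the truncated difference computes to `p + p * suc p`, so the ring identity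
    -- involves no subtraction.
    2 * (c * c ∸ 1)  ≡⟨ cong (2 *_) (ring p) ⟩
    2 * (q * p)      ≡⟨ cong (2 *_) qp≡mN ⟩
    2 * (m * N)      ≡⟨ ring₂ m N ⟩
    m * (N + N)      ≡⟨ cong (m *_) N+N≡n ⟩
    m * n            ∎
    where
    open ≡-Reasoning
    ring : ∀ a → a + a * suc a ≡ suc (suc a) * a
    ring = ℕ-Ring.solve-∀
    ring₂ : ∀ a b → 2 * (a * b) ≡ a * (b + b)
    ring₂ = ℕ-Ring.solve-∀
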